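{- Suppose $(\varepsilon,\beta,\gamma;(12))\in\mathrm{Par}(n)$. Fix a positive integer $d$, and let $r$ be the number of cycles of $\beta$ of length $d$. Let $f$ be the number of fixed points of $\gamma$. If $r>0$, then: <ul> <li>(i) $f\le (r-1)d$ if $d$ is even;</li> <li>(ii) $f\le (r-1)d+1$ if $d$ is odd.</li> </ul>
   Context: A Latin square of order $n$ is an $n\times n$ array with rows, columns and symbols indexed by $[n]$, each symbol occurring once in each row and each column, with triple set $O(L)$. Permutations act on the right; $\varepsilon$ is the identity; fixed points count as cycles of length $1$. A paratopism $(\alpha,\beta,\gamma;(12))$ maps $L$ to $L^\sigma$ with triple set $\{(y\beta,x\alpha,z\gamma):(x,y,z)\in O(L)\}$; it is an autoparatopism of $L$ if $L^\sigma=L$. $\mathrm{Par}(n)$ is the set of paratopisms that are autoparatopisms of at least one Latin square of order $n$. -}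

module Defs where

open import Data.Bool.Properties using () renaming (_≟_ to _≟ᵇ_)
open import Data.Fin.Base using (Fin)
open import Data.Fin.Patterns using (0F; 1F; 2F)
open import Data.Fin.Permutation using (Permutation′; _⟨$⟩ʳ_; _⟨$⟩ˡ_; transpose)
open import Data.Fin.Properties using (_≟_)
open import Data.Fin.Subset using (Subset; ⁅_⁆; ⋃; ∣_∣)
open import Data.List.Base using (List; map; filter; length; allFin; iterate; deduplicate)
open import Data.Nat.Base using (ℕ)
open import Data.Nat.Properties using () renaming (_≟_ to _≟ⁿ_)
open import Data.Product using (∃; ∃!; _×_; _,_)
open import Data.Vec.Properties using (≡-dec)
open import Level using (0ℓ)
open import Relation.Binary.PropositionalEquality using (_≡_; refl)
open import Relation.Unary using (Pred; _∈_; _≐_)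

record LatinSquare (n : ℕ) : Set where
  field
    entry  : Fin n → Fin n → Fin n
    row    : ∀ x z → ∃! _≡_ λ y → entry x y ≡ z
    column : ∀ y z → ∃! _≡_ λ x → entry x y ≡ z

open LatinSquare public using (entry)

Triple : ℕ → Set
Triple n = Fin n × Fin n × Fin n

O : ∀ {n} → LatinSquare n → Pred (Triple n) 0ℓ
O L (x , y , z) = entry L x y ≡ z

record Paratopism (n : ℕ) : Set where
  constructor ⟨_,_,_∶_⟩
  field
    α β γ : Permutation′ n
    δ     : Permutation′ 3

-- The i-th coordinate, moved by the i-th of α, β, γ, is put in position iδ.
act : ∀ {n} → Paratopism n → Triple n → Triple n
act {n} ⟨ α , β , γ ∶ δ ⟩ (x , y , z) = at 0F , at 1F , at 2F
  where
  moved : Fin 3 → Fin n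
  moved 0F = α ⟨$⟩ʳ x
  moved 1F = β ⟨$⟩ʳ y
  moved 2F = γ ⟨$⟩ʳ z

  at : Fin 3 → Fin n
  at j = moved (δ ⟨$⟩ˡ j)

-- Positions 1, 2, 3 are 0F, 1F, 2F, so this is the transposition (12).
[12] : Permutation′ 3
[12] = transpose 0F 1F

act-[12] : ∀ {n} (α β γ : Permutation′ n) x y z →
           act ⟨ α , β , γ ∶ [12] ⟩ (x , y , z) ≡ (β ⟨$⟩ʳ y , α ⟨$⟩ʳ x , γ ⟨$⟩ʳ z)
act-[12] α β γ x y z = refl

-- The triple set of L^σ.
O^ : ∀ {n} → LatinSquare n → Paratopism n → Pred (Triple n) 0ℓ
O^ L σ t′ = ∃ λ t → t ∈ O L × t′ ≡ act σ t

IsAutoparatopism : ∀ {n} → Paratopism n → LatinSquare n → Set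
IsAutoparatopism σ L = O^ L σ ≐ O L

Par : (n : ℕ) → Pred (Paratopism n) 0ℓ
Par n σ = ∃ λ (L : LatinSquare n) → IsAutoparatopism σ L

-- The cycle through x as a set of points; a cycle of a permutation of Fin n
-- has at most n points, so the n iterates x, xπ, …, xπⁿ⁻¹ exhaust it.
cycleOf : ∀ {n} → Permutation′ n → Fin n → Subset n
cycleOf {n} π x = ⋃ (map ⁅_⁆ (iterate (π ⟨$⟩ʳ_) x n))

cycles : ∀ {n} → Permutation′ n → List (Subset n)
cycles {n} π = deduplicate (≡-dec _≟ᵇ_) (map (cycleOf π) (allFin n))

#cycles : ∀ {n} → Permutation′ n → ℕ → ℕ
#cycles π d = length (filter (λ C → ∣ C ∣ ≟ⁿ d) (cycles π))

#fixed : ∀ {n} → Permutation′ n → ℕ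
#fixed {n} π = length (filter (λ x → (π ⟨$⟩ʳ x) ≟ x) (allFin n))

{-# OPTIONS --safe #-}
-- Let x lie in a d-cycle C of β, and for a fixed point z of γ let y be the
-- column with L(x, y) = z.  The symmetry L(x, y)γ = L(yβ, x) shows that the
-- permutation x ↦ y is a square root of β⁻¹, so it commutes with β and y also
-- lies in a d-cycle.  If y = xβᵏ lies in C itself, then xβ²ᵏ⁺¹ = x, whence
-- d ∣ 2k + 1: this is impossible for even d, and it determines y.  As z ↦ y is
-- injective, f is at most the number (r - 1)d of points in the other d-cycles,
-- plus one if d is odd.
module Submission where

open import Defs
open import Data.Bool.Base using (true; false)
open import Data.Bool.Properties using () renaming (_≟_ to _≟ᵇ_)
open import Data.Fin.Base using (Fin; toℕ; fromℕ<)
open import Data.Fin.Permutation using (Permutation′; id; _⟨$⟩ʳ_; _⟨$⟩ˡ_; inverseˡ)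
open import Data.Fin.Properties using (_≟_; toℕ<n; toℕ-fromℕ<; toℕ-inject; pigeonhole; ¬∀⟶∃¬-smallest)
open import Data.Fin.Subset using (Subset; ⁅_⁆; ⋃; ∣_∣; _∪_; _⊆_) renaming (_∈_ to _∈ˢ_; _∉_ to _∉ˢ_)
open import Data.Fin.Subset.Properties using (∣⊥∣≡0; ∣⁅x⁆∣≡1; x∈⁅x⁆; x∈⁅y⁆⇒x≡y; ∉⊥; x∈p∪q⁺; x∈p∪q⁻; p⊆q⇒∣p∣≤∣q∣; x∈p∧x≢y⇒x∈p-y; x∈p⇒∣p-x∣<∣p∣; _∈?_)
open import Data.List.Base as List using (List; []; _∷_; length; map; filter; allFin; applyUpTo)
open import Data.List.Membership.Propositional using (find; lose) renaming (_∈_ to _∈ˡ_)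
open import Data.List.Membership.Propositional.Properties using (∈-map⁺; ∈-map⁻; ∈-applyUpTo⁺; ∈-applyUpTo⁻; ∈-filter⁺; ∈-filter⁻; ∈-deduplicate⁺; ∈-deduplicate⁻; ∈-allFin)
open import Data.List.Properties using (length-map; length-applyUpTo)
open import Data.List.Relation.Unary.All as All using (All; []; _∷_)
open import Data.List.Relation.Unary.All.Properties as All using ()
open import Data.List.Relation.Unary.Any as Any using (here; there)
open import Data.List.Relation.Unary.AllPairs using ([]; _∷_)
open import Data.List.Relation.Unary.Unique.Propositional using (Unique)
import Data.List.Relation.Unary.Unique.Propositional.Properties as Unique
open import Data.Nat.Base using (ℕ; zero; suc; _+_; _*_; _∸_; _≤_; _<_; _>_; z≤n; s≤s; NonZero)
open import Data.Nat.Divisibility using (_∣_; _∤_; ∣-trans; ∣-antisym; ∣m+n∣m⇒∣n; m∣m*n; m%n≡0⇒n∣m; ∣1⇒≡1)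
open import Data.Nat.DivMod using (_/_; _%_; m≡m%n+[m/n]*n; m%n<n)
open import Data.Nat.GeneralisedArithmetic using (iterate)
open import Data.Nat.Properties using (≤-refl; ≤-reflexive; ≤-trans; ≤-antisym; <-≤-trans; n<1+n; m≤n⇒m≤1+n; m≤m+n; m≤n+m; +-comm; +-suc; +-mono-≤; +-monoʳ-≤; *-identityʳ; m≤n⇒∃[o]m+o≡n; module ≤-Reasoning) renaming (_≟_ to _≟ⁿ_)
open import Data.Nat.Tactic.RingSolver using (solve-∀)
open import Data.Product using (∃; _×_; _,_; proj₁; proj₂)
open import Data.Sum.Base using (inj₁; inj₂)
open import Data.Vec.Base using ([]; _∷_)
open import Data.Vec.Properties using (≡-dec)
open import Function.Base using (_∘_)
open import Function.Definitions using (Injective)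
open import Relation.Binary.PropositionalEquality using (_≡_; _≢_; refl; sym; trans; cong; subst; module ≡-Reasoning)
open import Relation.Nullary using (¬_; yes; no; contradiction; ¬?)
open import Relation.Nullary.Decidable using (decidable-stable)
open import Relation.Unary using (_∈_)

private
  variable
    n : ℕ

-- Finite subsets and lists

∣p∪q∣≤∣p∣+∣q∣ : (p q : Subset n) → ∣ p ∪ q ∣ ≤ ∣ p ∣ + ∣ q ∣
∣p∪q∣≤∣p∣+∣q∣ []          []          = z≤n
∣p∪q∣≤∣p∣+∣q∣ (false ∷ p) (false ∷ q) = ∣p∪q∣≤∣p∣+∣q∣ p q
∣p∪q∣≤∣p∣+∣q∣ (false ∷ p) (true  ∷ q) =
  ≤-trans (s≤s (∣p∪q∣≤∣p∣+∣q∣ p q)) (≤-reflexive (sym (+-suc ∣ p ∣ ∣ q ∣)))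
∣p∪q∣≤∣p∣+∣q∣ (true  ∷ p) (false ∷ q) = s≤s (∣p∪q∣≤∣p∣+∣q∣ p q)
∣p∪q∣≤∣p∣+∣q∣ (true  ∷ p) (true  ∷ q) =
  s≤s (≤-trans (∣p∪q∣≤∣p∣+∣q∣ p q) (+-monoʳ-≤ ∣ p ∣ (m≤n⇒m≤1+n ≤-refl)))

∣⋃∣≤length*d : ∀ {d} {ps : List (Subset n)} →
               All (λ p → ∣ p ∣ ≡ d) ps → ∣ ⋃ ps ∣ ≤ length ps * d
∣⋃∣≤length*d {n} []                              = ≤-reflexive (∣⊥∣≡0 n)
∣⋃∣≤length*d {ps = p ∷ ps} (∣p∣≡d ∷ ∣ps∣≡d) =
  ≤-trans (∣p∪q∣≤∣p∣+∣q∣ p (⋃ ps)) (+-mono-≤ (≤-reflexive ∣p∣≡d) (∣⋃∣≤length*d ∣ps∣≡d))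

x∈⋃⁺ : ∀ {x : Fin n} {p ps} → p ∈ˡ ps → x ∈ˢ p → x ∈ˢ ⋃ ps
x∈⋃⁺ (here refl)  x∈p = x∈p∪q⁺ (inj₁ x∈p)
x∈⋃⁺ (there p∈ps) x∈p = x∈p∪q⁺ (inj₂ (x∈⋃⁺ p∈ps x∈p))

x∈⋃⁅xs⁆⁺ : ∀ {x : Fin n} {xs} → x ∈ˡ xs → x ∈ˢ ⋃ (map ⁅_⁆ xs)
x∈⋃⁅xs⁆⁺ {x = x} x∈xs = x∈⋃⁺ (∈-map⁺ ⁅_⁆ x∈xs) (x∈⁅x⁆ x)

x∈⋃⁅xs⁆⁻ : ∀ {x : Fin n} xs → x ∈ˢ ⋃ (map ⁅_⁆ xs) → x ∈ˡ xs
x∈⋃⁅xs⁆⁻ []       x∈⊥ = contradiction x∈⊥ ∉⊥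
x∈⋃⁅xs⁆⁻ (y ∷ xs) x∈∪ with x∈p∪q⁻ ⁅ y ⁆ _ x∈∪
... | inj₁ x∈⁅y⁆ = here (x∈⁅y⁆⇒x≡y y x∈⁅y⁆)
... | inj₂ x∈⋃   = there (x∈⋃⁅xs⁆⁻ xs x∈⋃)

∣⋃⁅xs⁆∣≤length : (xs : List (Fin n)) → ∣ ⋃ (map ⁅_⁆ xs) ∣ ≤ length xs
∣⋃⁅xs⁆∣≤length xs = begin
  ∣ ⋃ (map ⁅_⁆ xs) ∣       ≤⟨ ∣⋃∣≤length*d (All.map⁺ (All.universal ∣⁅x⁆∣≡1 xs)) ⟩
  length (map ⁅_⁆ xs) * 1  ≡⟨ *-identityʳ _ ⟩
  length (map ⁅_⁆ xs)      ≡⟨ length-map ⁅_⁆ xs ⟩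
  length xs                ∎
  where open ≤-Reasoning

-- Each further element of the list differs from the head `x`, so it lies in `p - x`, which is
-- strictly smaller than `p`; induct on the tail with that subset.
length≤∣p∣ : ∀ {xs : List (Fin n)} {p} → Unique xs → All (_∈ˢ p) xs → length xs ≤ ∣ p ∣
length≤∣p∣ []            []             = z≤n
length≤∣p∣ (x∉xs ∷ xs!) (x∈p ∷ xs⊆p) = <-≤-trans
  (s≤s (length≤∣p∣ xs! (All.zipWith (λ (x≢y , y∈p) → x∈p∧x≢y⇒x∈p-y y∈p (x≢y ∘ sym)) (x∉xs , xs⊆p))))
  (x∈p⇒∣p-x∣<∣p∣ x∈p)

length>0⇒∃∈ : ∀ {A : Set} (xs : List A) → length xs > 0 → ∃ (_∈ˡ xs)
length>0⇒∃∈ (x ∷ _) _ = x , here refl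

-- The exact drop in length is the source of the factor `r ∸ 1`, once `x` is taken to be one of the
-- `r` cycles of length `d`.
remove : ∀ {A : Set} {x : A} {xs} → x ∈ˡ xs → ∃ λ ys → length ys ≡ length xs ∸ 1 ×
         (∀ {y} → y ∈ˡ ys → y ∈ˡ xs) × (∀ {y} → y ∈ˡ xs → y ≢ x → y ∈ˡ ys)
remove {xs = _ ∷ xs} (here refl) = xs , refl , there , λ where
  (here refl) y≢x → contradiction refl y≢x
  (there y∈)  _   → y∈
remove {xs = w ∷ _ ∷ _} (there x∈) with ys , len , ys⊆ , ys⊇ ← remove x∈ =
  w ∷ ys , cong suc len
  , (λ { (here eq) → here eq ; (there y∈) → there (ys⊆ y∈) })
  , (λ { (here eq) _ → here eq ; (there y∈) y≢x → there (ys⊇ y∈ y≢x) })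

2∤k+suc[k] : ∀ k → 2 ∤ k + suc k
2∤k+suc[k] k 2∣ = contradiction
  (∣1⇒≡1 (∣m+n∣m⇒∣n (subst (2 ∣_) (double k) 2∣) (m∣m*n k))) λ ()
  where
  double : ∀ k → k + suc k ≡ 2 * k + 1
  double = solve-∀

-- Iteration and return times

iterate-+ : ∀ {A : Set} (f : A → A) x k l →
            iterate f x (k + l) ≡ iterate f (iterate f x k) l
iterate-+ f x zero    l = refl
iterate-+ f x (suc k) l = iterate-+ f (f x) k l

iterate-* : ∀ {A : Set} {f : A → A} {x k} q → iterate f x k ≡ x → iterate f x (q * k) ≡ x
iterate-* zero                _  = refl
iterate-* {f = f} {x} {k} (suc q) eq = begin
  iterate f x (k + q * k)              ≡⟨ iterate-+ f x k (q * k) ⟩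
  iterate f (iterate f x k) (q * k)    ≡⟨ cong (λ w → iterate f w (q * k)) eq ⟩
  iterate f x (q * k)                  ≡⟨ iterate-* q eq ⟩
  x                                    ∎
  where open ≡-Reasoning

iterate-*-+ : ∀ {A : Set} {f : A → A} {x k} q l → iterate f x k ≡ x →
              iterate f x (q * k + l) ≡ iterate f x l
iterate-*-+ {f = f} {x} {k} q l eq =
  trans (iterate-+ f x (q * k) l) (cong (λ w → iterate f w l) (iterate-* q eq))

iterate-injective : ∀ {A : Set} {f : A → A} → Injective _≡_ _≡_ f →
                    ∀ k → Injective _≡_ _≡_ (λ x → iterate f x k)
iterate-injective inj zero    eq = eq
iterate-injective inj (suc k) eq = inj (iterate-injective inj k eq)

list-iterate : ∀ {A : Set} (f : A → A) x n → List.iterate f x n ≡ applyUpTo (iterate f x) n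
list-iterate f x zero    = refl
list-iterate f x (suc n) = cong (x ∷_) (list-iterate f (f x) n)

-- Both points are reached after the same number j(2k + 1) + k = k(2j + 1) + j
-- of steps.
odd-return-unique : ∀ {A : Set} {f : A → A} {x} k j →
  iterate f x (k + suc k) ≡ x → iterate f x (j + suc j) ≡ x →
  iterate f x k ≡ iterate f x j
odd-return-unique {f = f} {x} k j eqₖ eqⱼ = begin
  iterate f x k                    ≡⟨ iterate-*-+ j k eqₖ ⟨
  iterate f x (j * (k + suc k) + k) ≡⟨ cong (iterate f x) (identity j k) ⟩
  iterate f x (k * (j + suc j) + j) ≡⟨ iterate-*-+ k j eqⱼ ⟩
  iterate f x j                    ∎
  where
  open ≡-Reasoning
  identity : ∀ j k → j * (k + suc k) + k ≡ k * (j + suc j) + j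
  identity = solve-∀

-- The least positive return time of `x`. Writing the smaller times as `suc k` leaves out the
-- trivial return at time 0.
record Period {A : Set} (f : A → A) (x : A) (m : ℕ) : Set where
  field
    {{nonZero}} : NonZero m
    return      : iterate f x m ≡ x
    minimal     : ∀ {k} → suc k < m → iterate f x (suc k) ≢ x

  return-% : ∀ k → iterate f x k ≡ iterate f x (k % m)
  return-% k = begin
    iterate f x k                    ≡⟨ cong (iterate f x) (trans (m≡m%n+[m/n]*n k m) (+-comm (k % m) _)) ⟩
    iterate f x (k / m * m + k % m)  ≡⟨ iterate-*-+ (k / m) (k % m) return ⟩
    iterate f x (k % m)              ∎
    where open ≡-Reasoning

  -- The remainder `k % m` is also a return time and is less than `m`, so minimality forces it to be
  -- 0.
  returns⇒∣ : ∀ {k} → iterate f x k ≡ x → m ∣ k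
  returns⇒∣ {k} eq = m%n≡0⇒n∣m k m (go (k % m) refl)
    where
    go : ∀ l → k % m ≡ l → l ≡ 0
    go zero    _     = refl
    go (suc l) k%m≡l = contradiction
      (trans (cong (iterate f x) (sym k%m≡l)) (trans (sym (return-% k)) eq))
      (minimal (subst (_< m) k%m≡l (m%n<n k m)))

  iterate-distinct : Injective _≡_ _≡_ f →
                     ∀ {i j} → i < j → j < m → iterate f x i ≢ iterate f x j
  -- With `j` equal to `suc i + o`, cancelling `i` steps by injectivity leaves a return at time
  -- `suc o`, which is below `m`.
  iterate-distinct inj {i} i<j j<m eq with m≤n⇒∃[o]m+o≡n i<j
  ... | o , refl = minimal (≤-trans (s≤s (s≤s (m≤n+m o i))) j<m)
    (iterate-injective inj i (trans (sym (iterate-+ f x (suc o) i))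
      (trans (cong (iterate f x ∘ suc) (+-comm o i)) (sym eq))))

-- Among the `n + 1` iterates at times 0 to `n` two coincide, and injectivity turns their distance
-- into a return time. The index `i : Fin n` stands for time `suc (toℕ i)`, so the search for the
-- least one also yields `m ≤ n`.
period-exists : {f : Fin n → Fin n} → Injective _≡_ _≡_ f →
                ∀ x → ∃ λ m → m ≤ n × Period f x m
period-exists {n} {f} inj x = suc (toℕ i) , toℕ<n i , record
  { return  = decidable-stable (iterate f x (suc (toℕ i)) ≟ x) ¬¬return
  ; minimal = λ { {k} (s≤s k<i) → subst (λ l → iterate f x (suc l) ≢ x)
                    (trans (toℕ-inject (fromℕ< k<i)) (toℕ-fromℕ< k<i)) (before (fromℕ< k<i)) }
  }
  where
  P : Fin n → Set
  P i = iterate f x (suc (toℕ i)) ≢ x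

  ¬∀P : ¬ (∀ i → P i)
  ¬∀P p with pigeonhole (n<1+n n) (iterate f x ∘ toℕ)
  ... | i , j , i<j , eq with m≤n⇒∃[o]m+o≡n i<j
  ... | o , i+o≡j = p (fromℕ< o<n) (subst (λ l → iterate f x (suc l) ≡ x) (sym (toℕ-fromℕ< o<n))
    (iterate-injective inj (toℕ i) (trans (sym (iterate-+ f x (suc o) (toℕ i)))
      (trans (cong (iterate f x) (trans (cong suc (+-comm o (toℕ i))) i+o≡j)) (sym eq)))))
    where
    o<n : o < n
    o<n with s≤s j≤n ← toℕ<n j =
      ≤-trans (≤-trans (s≤s (m≤n+m o (toℕ i))) (≤-reflexive i+o≡j)) j≤n

  smallest = ¬∀⟶∃¬-smallest n P (λ i → ¬? (iterate f x (suc (toℕ i)) ≟ x)) ¬∀P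
  i        = proj₁ smallest
  ¬¬return = proj₁ (proj₂ smallest)
  before   = proj₂ (proj₂ smallest)

-- Cycles of a permutation

module Cycles {n : ℕ} (π : Permutation′ n) where

  to : Fin n → Fin n
  to = π ⟨$⟩ʳ_

  to-injective : Injective _≡_ _≡_ to
  to-injective eq = trans (sym (inverseˡ π)) (trans (cong (π ⟨$⟩ˡ_) eq) (inverseˡ π))

  ∈-cycleOf⁺ : ∀ {x k} → k < n → iterate to x k ∈ˢ cycleOf π x
  ∈-cycleOf⁺ {x} {k} k<n = x∈⋃⁅xs⁆⁺
    (subst (iterate to x k ∈ˡ_) (sym (list-iterate to x n)) (∈-applyUpTo⁺ (iterate to x) k<n))

  ∈-cycleOf⁻ : ∀ {x y} → y ∈ˢ cycleOf π x → ∃ λ k → y ≡ iterate to x k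
  ∈-cycleOf⁻ {x} {y} y∈ with ∈-applyUpTo⁻ (iterate to x)
                          (subst (y ∈ˡ_) (list-iterate to x n) (x∈⋃⁅xs⁆⁻ _ y∈))
  ... | k , _ , eq = k , eq

  self∈cycleOf : ∀ x → x ∈ˢ cycleOf π x
  self∈cycleOf x = ∈-cycleOf⁺ (≤-trans (s≤s z≤n) (toℕ<n x))

  -- Reducing exponents modulo `m` puts every point of the cycle among the first `m` iterates.
  -- Conversely these are distinct, and `m ≤ n` ensures that the `n` iterates defining `cycleOf`
  -- include them.
  ∣cycleOf∣≡period : ∀ {x m} → m ≤ n → Period to x m → ∣ cycleOf π x ∣ ≡ m
  ∣cycleOf∣≡period {x} {m} m≤n per = ≤-antisym
    (begin
      ∣ cycleOf π x ∣         ≤⟨ p⊆q⇒∣p∣≤∣q∣ cycle⊆ ⟩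
      ∣ ⋃ (map ⁅_⁆ points) ∣  ≤⟨ ∣⋃⁅xs⁆∣≤length points ⟩
      length points           ≡⟨ length-applyUpTo _ m ⟩
      m                       ∎)
    (begin
      m                       ≡⟨ length-applyUpTo _ m ⟨
      length points           ≤⟨ length≤∣p∣ (Unique.applyUpTo⁺₁ _ m (iterate-distinct to-injective))
                                   (All.applyUpTo⁺₁ _ m (λ k<m → ∈-cycleOf⁺ (≤-trans k<m m≤n))) ⟩
      ∣ cycleOf π x ∣         ∎)
    where
    open ≤-Reasoning
    open Period per
    points = applyUpTo (iterate to x) m

    cycle⊆ : cycleOf π x ⊆ ⋃ (map ⁅_⁆ points)
    cycle⊆ y∈ with ∈-cycleOf⁻ y∈
    ... | k , refl = x∈⋃⁅xs⁆⁺
      (subst (_∈ˡ points) (sym (return-% k)) (∈-applyUpTo⁺ (iterate to x) (m%n<n k m)))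

  period-cycleOf : ∀ x → Period to x ∣ cycleOf π x ∣
  period-cycleOf x with period-exists to-injective x
  ... | m , m≤n , per = subst (Period to x) (sym (∣cycleOf∣≡period m≤n per)) per

  -- Points with the same return times have periods that divide each other.
  ∣cycleOf∣-cong : ∀ {x y} →
    (∀ k → iterate to x k ≡ x → iterate to y k ≡ y) →
    (∀ k → iterate to y k ≡ y → iterate to x k ≡ x) →
    ∣ cycleOf π x ∣ ≡ ∣ cycleOf π y ∣
  ∣cycleOf∣-cong {x} {y} x⇒y y⇒x = ∣-antisym
    (X.returns⇒∣ (y⇒x ∣ cycleOf π y ∣ Y.return))
    (Y.returns⇒∣ (x⇒y ∣ cycleOf π x ∣ X.return))
    where
    module X = Period (period-cycleOf x)
    module Y = Period (period-cycleOf y)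

  cyclesOfLength : ℕ → List (Subset n)
  cyclesOfLength d = filter (λ C → ∣ C ∣ ≟ⁿ d) (cycles π)

  ∈-cyclesOfLength⁺ : ∀ {d x} → ∣ cycleOf π x ∣ ≡ d → cycleOf π x ∈ˡ cyclesOfLength d
  ∈-cyclesOfLength⁺ {d} {x} = ∈-filter⁺ (λ C → ∣ C ∣ ≟ⁿ d)
    (∈-deduplicate⁺ (≡-dec _≟ᵇ_) (∈-map⁺ (cycleOf π) (∈-allFin x)))

  ∈-cyclesOfLength⁻ : ∀ {d C} → C ∈ˡ cyclesOfLength d → (∃ λ x → C ≡ cycleOf π x) × ∣ C ∣ ≡ d
  ∈-cyclesOfLength⁻ {d} {C} C∈
    with C∈cycles , ∣C∣≡d ← ∈-filter⁻ (λ C → ∣ C ∣ ≟ⁿ d) {v = C} {xs = cycles π} C∈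
    with x , _ , C≡ ← ∈-map⁻ (cycleOf π)
                        (∈-deduplicate⁻ (≡-dec _≟ᵇ_) (map (cycleOf π) (allFin n)) C∈cycles)
    = (x , C≡) , ∣C∣≡d

  #cycles>0⇒∃cycleOf : ∀ {d} → #cycles π d > 0 → ∃ λ x → ∣ cycleOf π x ∣ ≡ d
  #cycles>0⇒∃cycleOf {d} r>0 with C , C∈ ← length>0⇒∃∈ (cyclesOfLength d) r>0
    with (x , refl) , ∣C∣≡d ← ∈-cyclesOfLength⁻ C∈ = x , ∣C∣≡d

  otherCycles : ∀ {d} x → ∣ cycleOf π x ∣ ≡ d → ∃ λ (S : Subset n) →
    ∣ S ∣ ≤ (#cycles π d ∸ 1) * d ×
    (∀ {y} → ∣ cycleOf π y ∣ ≡ d → y ∉ˢ cycleOf π x → y ∈ˢ S)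
  otherCycles {d} x ∣x∣≡d
    with Cs , len , Cs⊆ , Cs⊇ ← remove (∈-cyclesOfLength⁺ ∣x∣≡d)
    = ⋃ Cs
    , ≤-trans (∣⋃∣≤length*d (All.tabulate (proj₂ ∘ ∈-cyclesOfLength⁻ ∘ Cs⊆)))
              (≤-reflexive (cong (_* d) len))
    , λ {y} ∣y∣≡d y∉ → x∈⋃⁺
        -- The cycle of `y` survives the deletion: it contains `y`, so it differs as a set from the
        -- cycle of `x`.
        (Cs⊇ (∈-cyclesOfLength⁺ ∣y∣≡d) λ eq → y∉ (subst (y ∈ˢ_) eq (self∈cycleOf y)))
        (self∈cycleOf y)

-- Latin squares invariant under (ε, β, γ; (12))

module SymmetricSquare {n : ℕ} (β γ : Permutation′ n) (L : LatinSquare n)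
  (auto : IsAutoparatopism ⟨ id , β , γ ∶ [12] ⟩ L) where

  open Cycles β
  open LatinSquare L using (row; column)

  private
    variable
      x y z : Fin n

  col : Fin n → Fin n → Fin n
  col x z = proj₁ (row x z)

  entry-col : ∀ x z → entry L x (col x z) ≡ z
  entry-col x z = proj₁ (proj₂ (row x z))

  col-injective : ∀ {z z′} → col x z ≡ col x z′ → z ≡ z′
  col-injective {x} {z} {z′} eq =
    trans (sym (entry-col x z)) (trans (cong (entry L x) eq) (entry-col x z′))

  row-unique : ∀ {y′} → entry L x y ≡ z → entry L x y′ ≡ z → y ≡ y′
  row-unique {x} {z = z} e e′ = trans (sym (proj₂ (proj₂ (row x z)) e)) (proj₂ (proj₂ (row x z)) e′)

  column-unique : ∀ {x′} → entry L x y ≡ z → entry L x′ y ≡ z → x ≡ x′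
  column-unique {y = y} {z} e e′ =
    trans (sym (proj₂ (proj₂ (column y z)) e)) (proj₂ (proj₂ (column y z)) e′)

  module _ (γz≡z : (γ ⟨$⟩ʳ z) ≡ z) where

    -- The autoparatopism sends the triple `(x , y , z)` to `(to y , x , γ ⟨$⟩ʳ z)`, whose last
    -- coordinate is again `z`.
    entry-swap : entry L x y ≡ z → entry L (to y) x ≡ z
    entry-swap {x} {y} e = trans (proj₁ auto ((x , y , z) , e , refl)) γz≡z

    -- Two swaps send the cell `(x , y)` to `(to x , to y)`. Thus the map from a row to the column
    -- of its `z` commutes with `β`.
    entry-iterate : ∀ k → entry L x y ≡ z → entry L (iterate to x k) (iterate to y k) ≡ z
    entry-iterate zero    e = e
    entry-iterate (suc k) e = entry-iterate k (entry-swap (entry-swap e))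

    -- When `x` returns after `k` steps, the moved cell lies in row `x` again and still holds `z`,
    -- so `y` returns as well; columns give the converse.
    ∣cycleOf-col∣ : entry L x y ≡ z → ∣ cycleOf β x ∣ ≡ ∣ cycleOf β y ∣
    ∣cycleOf-col∣ {x} {y} e = ∣cycleOf∣-cong
      (λ k x↺ → row-unique (subst (λ w → entry L w _ ≡ z) x↺ (entry-iterate k e)) e)
      (λ k y↺ → column-unique (subst (λ w → entry L _ w ≡ z) y↺ (entry-iterate k e)) e)

    same-cycle⇒odd-return : ∀ k → entry L x (iterate to x k) ≡ z → iterate to x (k + suc k) ≡ x
    same-cycle⇒odd-return {x} k e = trans (iterate-+ to x k (suc k))
      -- Row `xβᵏ⁺¹` holds `z` at column `xβ²ᵏ⁺¹`, by moving the cell `suc k` times, and at column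
      -- `x`, by one swap.
      (row-unique (entry-iterate (suc k) e)
        (subst (λ w → entry L w x ≡ z) (to-iterate x k) (entry-swap e)))
      where
      to-iterate : ∀ x k → to (iterate to x k) ≡ iterate to x (suc k)
      to-iterate x zero    = refl
      to-iterate x (suc k) = to-iterate (to x) k

  fixedPoints : List (Fin n)
  fixedPoints = filter (λ z → (γ ⟨$⟩ʳ z) ≟ z) (allFin n)

  fixed : z ∈ˡ fixedPoints → (γ ⟨$⟩ʳ z) ≡ z
  fixed = proj₂ ∘ ∈-filter⁻ (λ z → (γ ⟨$⟩ʳ z) ≟ z) {xs = allFin n}

  -- Within row `x`, distinct symbols occupy distinct columns, so `f` is at most the size of any set
  -- that catches the columns of all fixed symbols.
  #fixed≤∣p∣ : ∀ {p} x → (∀ {z} → z ∈ˡ fixedPoints → col x z ∈ˢ p) → #fixed γ ≤ ∣ p ∣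
  #fixed≤∣p∣ {p} x col∈p = ≤-trans
    (≤-reflexive (sym (length-map (col x) fixedPoints)))
    (length≤∣p∣ (Unique.map⁺ col-injective (Unique.filter⁺ _ (Unique.allFin⁺ n)))
                (All.map⁺ (All.tabulate col∈p)))

  module _ {d : ℕ} (x : Fin n) (∣x∣≡d : ∣ cycleOf β x ∣ ≡ d) where

    private
      S    = proj₁ (otherCycles x ∣x∣≡d)
      ∣S∣≤ = proj₁ (proj₂ (otherCycles x ∣x∣≡d))

    col∉⇒col∈S : z ∈ˡ fixedPoints → col x z ∉ˢ cycleOf β x → col x z ∈ˢ S
    col∉⇒col∈S {z} z∈ = proj₂ (proj₂ (otherCycles x ∣x∣≡d))
      (trans (sym (∣cycleOf-col∣ (fixed z∈) (entry-col x z))) ∣x∣≡d)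

    col∈cycle⇒odd-return : z ∈ˡ fixedPoints → col x z ∈ˢ cycleOf β x →
      ∃ λ k → col x z ≡ iterate to x k × iterate to x (k + suc k) ≡ x
    col∈cycle⇒odd-return {z} z∈ col∈ with k , eq ← ∈-cycleOf⁻ col∈ =
      k , eq , same-cycle⇒odd-return (fixed z∈) k
                 (subst (λ w → entry L x w ≡ z) eq (entry-col x z))

    even-bound : 2 ∣ d → #fixed γ ≤ (#cycles β d ∸ 1) * d
    even-bound 2∣d = ≤-trans
      (#fixed≤∣p∣ x λ z∈ → col∉⇒col∈S z∈ λ col∈ → no-odd-return (col∈cycle⇒odd-return z∈ col∈))
      ∣S∣≤
      where
      no-odd-return : ∀ {y} → ¬ (∃ λ k → y ≡ iterate to x k × iterate to x (k + suc k) ≡ x)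
      -- The odd return time `k + suc k` is a multiple of `d`, hence would be even.
      no-odd-return (k , _ , return) = 2∤k+suc[k] k (∣-trans 2∣d
        (subst (_∣ k + suc k) ∣x∣≡d (Period.returns⇒∣ (period-cycleOf x) return)))

    bound : #fixed γ ≤ (#cycles β d ∸ 1) * d + 1
    bound with Any.any? (λ z → col x z ∈? cycleOf β x) fixedPoints
    ... | no none = ≤-trans
      (#fixed≤∣p∣ x λ z∈ → col∉⇒col∈S z∈ λ col∈ → none (lose z∈ col∈))
      (≤-trans ∣S∣≤ (m≤m+n _ 1))
    -- The column `xβʲ` of one such symbol `z₀` serves as reference: it is the single point to be
    -- added to `S`.
    ... | yes some with z₀ , z₀∈ , col₀∈ ← find some
      with j , eqⱼ , retⱼ ← col∈cycle⇒odd-return z₀∈ col₀∈ = begin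
        #fixed γ                       ≤⟨ #fixed≤∣p∣ x col∈S∪⁅y⁆ ⟩
        ∣ S ∪ ⁅ iterate to x j ⁆ ∣     ≤⟨ ∣p∪q∣≤∣p∣+∣q∣ S _ ⟩
        ∣ S ∣ + ∣ ⁅ iterate to x j ⁆ ∣ ≤⟨ +-mono-≤ ∣S∣≤ (≤-reflexive (∣⁅x⁆∣≡1 (iterate to x j))) ⟩
        (#cycles β d ∸ 1) * d + 1      ∎
      where
      open ≤-Reasoning

      col∈S∪⁅y⁆ : ∀ {z} → z ∈ˡ fixedPoints → col x z ∈ˢ S ∪ ⁅ iterate to x j ⁆
      col∈S∪⁅y⁆ {z} z∈ with col x z ∈? cycleOf β x
      ... | no  col∉ = x∈p∪q⁺ (inj₁ (col∉⇒col∈S z∈ col∉))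
      -- Both `k + suc k` and `j + suc j` are return times of `x`, so this column is the reference
      -- column.
      ... | yes col∈ with k , eqₖ , retₖ ← col∈cycle⇒odd-return z∈ col∈ =
        x∈p∪q⁺ (inj₂ (subst (_∈ˢ ⁅ iterate to x j ⁆)
          (sym (trans eqₖ (odd-return-unique k j retₖ retⱼ))) (x∈⁅x⁆ (iterate to x j))))

theorem4p4 : (n : ℕ) (β γ : Permutation′ n) →
    ⟨ id , β , γ ∶ [12] ⟩ ∈ Par n →
    (d : ℕ) → d > 0 →
    let r = #cycles β d
        f = #fixed γ
    in r > 0 →
    (2 ∣ d → f ≤ (r ∸ 1) * d) × (2 ∤ d → f ≤ (r ∸ 1) * d + 1)
-- Since `r` is positive, some point `x` lies on a `d`-cycle; the whole count takes place in row `x`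
-- of `L`.
theorem4p4 n β γ (L , auto) d _ r>0 with x , ∣x∣≡d ← Cycles.#cycles>0⇒∃cycleOf β r>0 =
  even-bound x ∣x∣≡d , λ _ → bound x ∣x∣≡d
  where open SymmetricSquare β γ L auto
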